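{- Let $\mathcal{T}$ be a trie with $N$ edges. Then there are at most $N+1$ distinct palindromes in $\mathcal{T}$ (the empty string being counted).
   Context: A trie $\mathcal{T}=(V,E)$ is a (finite) rooted tree whose edges are labeled by characters of an alphabet $\Sigma$ so that the out-going edges of every node (the edges to its children) carry pairwise distinct labels. For nodes $u,v$ such that $u=v$ or $u$ is an ancestor of $v$, $\mathsf{str}(u,v)$ is the concatenation of the edge labels along the downward path from $u$ to $v$ (the empty string $\varepsilon$ if $u=v$). A string is a palindrome if it equals its reversal; $\varepsilon$ is a palindrome. The distinct palindromes in $\mathcal{T}$ are the elements of the set of strings $\{\mathsf{str}(u,v) : \mathsf{str}(u,v) \text{ is a palindrome}\}$. -}

module Defs where

open import Level using (Level; _⊔_)
open import Data.Nat using (ℕ; suc; _+_; _≤_)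
open import Data.List using (List; []; _∷_; map; length; reverse)
open import Data.List.Membership.Propositional using (_∈_)
open import Data.List.Relation.Unary.All using (All)
open import Data.List.Relation.Unary.Unique.Propositional using (Unique)
open import Data.Product using (_×_; _,_; proj₁; proj₂; ∃-syntax)
open import Relation.Binary.PropositionalEquality using (_≡_)
open import Relation.Unary using (Pred)

private variable
  a p : Level
  A : Set a

-- Each entry (c , t) of the list is an out-going edge labelled c, leading to
-- the child whose subtree is t.
data Tree (A : Set a) : Set a where
  node : List (A × Tree A) → Tree A

data IsTrie {A : Set a} : Tree A → Set a where
  node : ∀ {es} → Unique (map proj₁ es) → All (λ e → IsTrie (proj₂ e)) es →
         IsTrie (node es)

record Trie (A : Set a) : Set a where
  field
    tree   : Tree A
    isTrie : IsTrie tree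

open Trie public

mutual
  #edges : Tree A → ℕ
  #edges (node es) = #edgesₗ es

  #edgesₗ : List (A × Tree A) → ℕ
  #edgesₗ []             = 0
  #edgesₗ ((_ , t) ∷ es) = suc (#edges t) + #edgesₗ es

data Node {A : Set a} : Tree A → Set a where
  root  : ∀ {t} → Node t
  below : ∀ {es c t} → (c , t) ∈ es → Node t → Node (node es)

subtree : {t : Tree A} → Node t → Tree A
subtree {t = t} root = t
subtree (below _ u)  = subtree u

-- The nodes v such that u = v or u is an ancestor of v are the nodes of the
-- subtree hanging from u.
Descendant : {t : Tree A} → Node t → Set _
Descendant u = Node (subtree u)

rootWord : {t : Tree A} → Node t → List A
rootWord root                = []
rootWord (below {c = c} _ v) = c ∷ rootWord v

str : {t : Tree A} (u : Node t) → Descendant u → List A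
str u v = rootWord v

Palindrome : Pred (List A) _
Palindrome w = w ≡ reverse w

PalindromeIn : Tree A → Pred (List A) _
PalindromeIn t w = ∃[ u ] ∃[ v ] (str {t = t} u v ≡ w × Palindrome w)

-- The subset P of X has at most n elements.
AtMost : {X : Set a} → ℕ → Pred X p → Set (a ⊔ p)
AtMost n P = ∀ xs → Unique xs → All P xs → length xs ≤ n

{-# OPTIONS --safe #-}
module Submission where

-- Every node v determines the longest palindromic suffix of the word read from
-- the root to v, so it suffices that each palindrome w of the tree arises in
-- this way.  Among the nodes whose root word ends with w, the shallowest one
-- works: a longer palindromic suffix q of its root word would end with w,
-- hence, being a palindrome, also begin with w, which exhibits an occurrence of
-- w ending at a proper ancestor.
--
-- Equality of labels is not assumed decidable, so the shallowest node is only
-- found up to double negation; this is harmless because _≤_ is stable.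

open import Defs
open import Level using (Level)
open import Data.Nat using (ℕ; suc; _+_; _≤_; _<_; z≤n; s≤s; _≤?_)
open import Data.Nat.Induction using (<-wellFounded)
open import Data.Nat.Properties
  using (≤-antisym; ≤-reflexive; ≮⇒≥; <⇒≤; m<m+n; m+n≮n; +-comm)
open import Data.Fin using (zero; suc)
open import Data.Fin.Properties using (injective⇒≤)
open import Data.List using (List; []; _∷_; _++_; map; length; lookup; reverse)
open import Data.List.Properties
  using (length-++; length-map; ++-assoc; reverse-++; ∷-injective)
open import Data.List.Membership.Propositional using (_∈_; lose)
open import Data.List.Membership.Propositional.Properties
  using (∈-lookup; ∈-map⁺; ∈-++⁺ˡ; ∈-++⁺ʳ)
open import Data.List.Relation.Unary.All as All using (All; _∷_)
open import Data.List.Relation.Unary.AllPairs using (_∷_)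
open import Data.List.Relation.Unary.Any as Any using (Any; here; there)
open import Data.List.Relation.Unary.Any.Properties using (lookup-index)
open import Data.List.Relation.Unary.Unique.Propositional using (Unique)
open import Data.Product using (_×_; _,_; ∃-syntax)
open import Function using (_∘_)
open import Induction.WellFounded using (Acc; acc)
open import Relation.Binary.PropositionalEquality
  using (_≡_; refl; sym; trans; cong; cong₂; subst; module ≡-Reasoning)
open import Relation.Nullary using (¬_; contradiction)
open import Relation.Nullary.Decidable using (decidable-stable)
open import Relation.Nullary.Negation using (¬¬-map; ¬¬-Monad)

private variable
  a b r : Level
  A : Set a
  B : Set b

lookup-injective : ∀ {xs : List A} → Unique xs → ∀ i j →
                   lookup xs i ≡ lookup xs j → i ≡ j
lookup-injective (_    ∷ _)  zero    zero    _  = refl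
lookup-injective (x∉xs ∷ _)  zero    (suc j) eq =
  contradiction eq (All.lookup x∉xs (∈-lookup j))
lookup-injective (x∉xs ∷ _)  (suc i) zero    eq =
  contradiction (sym eq) (All.lookup x∉xs (∈-lookup i))
lookup-injective (_    ∷ !xs) (suc i) (suc j) eq =
  cong suc (lookup-injective !xs i j eq)

-- Sending each position in `xs` to the position of a related entry in `ys` is an injection between
-- finite index sets. A relation stands in for a function because longest palindromic suffixes are
-- only known to exist up to double negation.
length-≤-by-relation : {R : A → B → Set r} →
                       (∀ {x x′ y} → R x y → R x′ y → x ≡ x′) →
                       ∀ {xs ys} → Unique xs → All (λ x → Any (R x) ys) xs →
                       length xs ≤ length ys
length-≤-by-relation {R = R} R-injective {xs} {ys} !xs hits =
  injective⇒≤ {f = Any.index ∘ hit} λ {i} {j} eq →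
    lookup-injective !xs i j
      (R-injective (lookup-index (hit i))
        (subst (R (lookup xs j) ∘ lookup ys) (sym eq) (lookup-index (hit j))))
  where
  hit : ∀ i → Any (R (lookup xs i)) ys
  hit i = All.lookup hits (∈-lookup i)

-- A form of Levi's lemma: the lengths decide which factorisation is cut first.
++-align : ∀ (u {w} v {q} : List A) → u ++ w ≡ v ++ q → length w ≤ length q →
           ∃[ c ] (u ≡ v ++ c × q ≡ c ++ w)
++-align u       []      eq _ = u , refl , sym eq
-- Here `w` is `y ∷ v ++ q`, which is longer than `q`.
++-align []      (y ∷ v) {q} refl |w|≤|q| =
  contradiction (subst (_≤ length q) (cong suc (length-++ v)) |w|≤|q|) (m+n≮n (length v) _)
++-align (x ∷ u) (y ∷ v) eq |w|≤|q| with ∷-injective eq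
... | refl , eq′ with ++-align u v eq′ |w|≤|q|
... | c , refl , q≡c++w = c , refl , q≡c++w

++-cancel-length : ∀ (u {w} v {q} : List A) → u ++ w ≡ v ++ q →
                   length w ≡ length q → w ≡ q
++-cancel-length u {w} v eq |w|≡|q| with ++-align u v eq (≤-reflexive |w|≡|q|)
... | []    , _ , refl = refl
... | _ ∷ c , _ , refl =
  contradiction (≤-reflexive (trans (cong suc (sym (length-++ c))) (sym |w|≡|q|)))
                (m+n≮n (length c) _)

record LongestPalindromicSuffix {A : Set a} (w x : List A) : Set a where
  constructor longest
  field
    palindrome : Palindrome w
    before     : List A
    isSuffix   : x ≡ before ++ w
    maximal    : ∀ v q → Palindrome q → x ≡ v ++ q → length q ≤ length w

LongestPalindromicSuffix-unique : ∀ {w w′ x : List A} →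
  LongestPalindromicSuffix w x → LongestPalindromicSuffix w′ x → w ≡ w′
LongestPalindromicSuffix-unique (longest pal u x≡uw max) (longest pal′ u′ x≡u′w′ max′) =
  ++-cancel-length u u′ (trans (sym x≡uw) x≡u′w′)
    (≤-antisym (max′ u _ pal x≡uw) (max u′ _ pal′ x≡u′w′))

-- Aligning the suffixes gives `q = c ++ w`. Reversing this, with `q` and `w` palindromes, gives
-- `q = w ++ reverse c`, so `w` also occurs right after `v`; this is earlier because `u = v ++ c`
-- with `c` non-empty.
longer-palindrome⇒earlier : ∀ (u {w} v {q} : List A) → Palindrome w → Palindrome q →
  u ++ w ≡ v ++ q → length w < length q →
  length v < length u × ∃[ z ] (u ++ w ≡ (v ++ w) ++ z)
longer-palindrome⇒earlier u {w} v {q} pal-w pal-q eq |w|<|q|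
  with ++-align u v eq (<⇒≤ |w|<|q|)
-- An empty `c` would force `q = w`.
... | []    , _    , refl = contradiction |w|<|q| (m+n≮n 0 _)
... | c@(_ ∷ _) , refl , refl =
  subst (length v <_) (sym (length-++ v)) (m<m+n _ (s≤s z≤n)) ,
  reverse c , (begin
    (v ++ c) ++ w                 ≡⟨ ++-assoc v c w ⟩
    v ++ (c ++ w)                 ≡⟨ cong (v ++_) pal-q ⟩
    v ++ reverse (c ++ w)         ≡⟨ cong (v ++_) (reverse-++ c w) ⟩
    v ++ (reverse w ++ reverse c) ≡⟨ cong (λ s → v ++ (s ++ reverse c)) pal-w ⟨
    v ++ (w ++ reverse c)         ≡⟨ ++-assoc v w (reverse c) ⟨
    (v ++ w) ++ reverse c         ∎)
  where open ≡-Reasoning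

-- One entry per node, with no merging of equal words: `[]` for the root, and for each edge the node
-- at its lower end.
mutual
  rootWords : Tree A → List (List A)
  rootWords (node es) = [] ∷ rootWordsₗ es

  rootWordsₗ : List (A × Tree A) → List (List A)
  rootWordsₗ []             = []
  rootWordsₗ ((c , t) ∷ es) = map (c ∷_) (rootWords t) ++ rootWordsₗ es

mutual
  length-rootWords : (t : Tree A) → length (rootWords t) ≡ suc (#edges t)
  length-rootWords (node es) = cong suc (length-rootWordsₗ es)

  length-rootWordsₗ : (es : List (A × Tree A)) → length (rootWordsₗ es) ≡ #edgesₗ es
  length-rootWordsₗ []             = refl
  length-rootWordsₗ ((c , t) ∷ es) = begin
    length (map (c ∷_) (rootWords t) ++ rootWordsₗ es)
      ≡⟨ length-++ (map (c ∷_) (rootWords t)) ⟩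
    length (map (c ∷_) (rootWords t)) + length (rootWordsₗ es)
      ≡⟨ cong₂ _+_ (trans (length-map (c ∷_) (rootWords t)) (length-rootWords t))
                   (length-rootWordsₗ es) ⟩
    suc (#edges t) + #edgesₗ es ∎
    where open ≡-Reasoning

∈-rootWordsₗ : ∀ {es : List (A × Tree A)} {c t w} → (c , t) ∈ es → w ∈ rootWords t →
               (c ∷ w) ∈ rootWordsₗ es
∈-rootWordsₗ (here refl) w∈t = ∈-++⁺ˡ (∈-map⁺ _ w∈t)
∈-rootWordsₗ {es = (c , t) ∷ _} (there e∈es) w∈t =
  ∈-++⁺ʳ (map (c ∷_) (rootWords t)) (∈-rootWordsₗ e∈es w∈t)

rootWord∈rootWords : ∀ {t : Tree A} (v : Node t) → rootWord v ∈ rootWords t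
rootWord∈rootWords {t = node _} root = here refl
rootWord∈rootWords (below e v)       = there (∈-rootWordsₗ e (rootWord∈rootWords v))

infixr 5 _·_

_·_ : ∀ {t : Tree A} (u : Node t) → Descendant u → Node t
root      · v = v
below e u · v = below e (u · v)

rootWord-· : ∀ {t : Tree A} (u : Node t) (v : Descendant u) →
             rootWord (u · v) ≡ rootWord u ++ str u v
rootWord-· root        v = refl
rootWord-· (below _ u) v = cong (_ ∷_) (rootWord-· u v)

-- The path to `v` is cut once `x` has been read. This turns an occurrence inside a root word into
-- one that ends at a node.
rootWord-prefix : ∀ {t : Tree A} (v : Node t) x {z} → rootWord v ≡ x ++ z →
                  ∃[ u ] (rootWord {t = t} u ≡ x)
rootWord-prefix v           []      _  = root , refl
rootWord-prefix (below e v) (y ∷ x) eq with ∷-injective eq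
... | refl , eq′ with rootWord-prefix v x eq′
... | u , refl = below e u , refl

¬¬LongestPalindromicSuffix : ∀ {t : Tree A} {w} → PalindromeIn t w →
  ¬ ¬ (∃[ v ] LongestPalindromicSuffix w (rootWord {t = t} v))
¬¬LongestPalindromicSuffix {t = t} {w} (u , v , refl , pal) none =
  no-occurrence (<-wellFounded _) (rootWord u) (u · v) refl (rootWord-· u v)
  where
  -- Infinite descent on `length p`: as `w` is fixed, this measures the depth at which the
  -- occurrence ends.
  no-occurrence : ∀ {n} → Acc _<_ n → ∀ p (v : Node t) → length p ≡ n →
                  ¬ (rootWord v ≡ p ++ w)
  no-occurrence (acc rec) p v refl v≡pw = none (v , longest pal p v≡pw maximal)
    where
    maximal : ∀ p′ q → Palindrome q → rootWord v ≡ p′ ++ q → length q ≤ length w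
    maximal p′ q pal-q v≡p′q = ≮⇒≥ λ |w|<|q| →
      let |p′|<|p| , _ , pw≡p′wz =
            longer-palindrome⇒earlier p p′ pal pal-q (trans (sym v≡pw) v≡p′q) |w|<|q|
          v′ , v′≡p′w = rootWord-prefix v (p′ ++ w) (trans v≡pw pw≡p′wz)
      in no-occurrence (rec |p′|<|p|) p′ v′ refl v′≡p′w

lemma4 : ∀ {a : Level} {A : Set a} (T : Trie A) (N : ℕ) → #edges (tree T) ≡ N →
    AtMost (N + 1) (PalindromeIn (tree T))
lemma4 {a} T _ refl xs !xs palindromes =
  subst (length xs ≤_) (trans (length-rootWords (tree T)) (+-comm 1 _))
    (decidable-stable (_ ≤? _)
      (¬¬-map (length-≤-by-relation {R = LongestPalindromicSuffix}
                                     LongestPalindromicSuffix-unique !xs)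
        -- Double negation commutes with finite conjunction, so the claims for the single
        -- palindromes combine into one for the whole list.
        (All.mapM a ¬¬-Monad
          (¬¬-map (λ (v , lps) → lose (rootWord∈rootWords v) lps)
            ∘ ¬¬LongestPalindromicSuffix)
          palindromes)))
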